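{- Let $I, J \geq 1$ be integers and let $\mathbf b = (b_{ij})_{1\le i\le I,\,1\le j\le J}$ be an array of positive integers (so every cell is bounded and there are no structural zeros). Then for every choice of row sums $(r_1,\dots,r_I) \in \mathbb N^I$ and column sums $(c_1,\dots,c_J)\in\mathbb N^J$, the set of all basic moves of $2\times 2$ minors (which is the standard Markov basis for $I \times J$ tables with fixed row and column sums and no bounds) is a Markov subbasis for the bounded tables with these margins. That is, with $$\mathcal F^{\mathbf b} = \Big\{ \mathbf n \in \mathbb N^{I\times J} \ :\ \sum_{j=1}^J n_{ij} = r_i \ \forall i,\ \ \sum_{i=1}^I n_{ij} = c_j\ \forall j,\ \ n_{ij} \le b_{ij}\ \forall i,j \Big\},$$ for any $\mathbf u, \mathbf v \in \mathcal F^{\mathbf b}$ there exist $l \geq 0$ and basic moves $\mathbf m_1,\dots,\mathbf m_l$ such that $\mathbf u = \mathbf v + \sum_{i=1}^l \mathbf m_i$ and $\mathbf v + \sum_{i=1}^{t} \mathbf m_i \in \mathcal F^{\mathbf b}$ for all $t = 1,\dots,l$.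
   Context: $\mathbb N = \{0,1,2,\dots\}$. For $1 \le i \le I$, $1\le j\le J$ let $E_{ij}$ denote the $I\times J$ integer array with entry $1$ in cell $(i,j)$ and $0$ elsewhere. A basic move is an array $\pm(E_{i_1j_1} + E_{i_2j_2} - E_{i_1j_2} - E_{i_2j_1})$ with $i_1 \ne i_2$ and $j_1 \ne j_2$ (both signs are allowed); it corresponds to a $2 \times 2$ minor of the table. A structural zero is a cell whose upper bound is $0$. -}

module Defs where

open import Data.Bool.Base using (if_then_else_; _∧_)
open import Data.Fin.Base using (Fin; inject≤)
open import Data.Fin.Properties using (_≟_)
open import Data.Integer.Base using (ℤ; +_; 0ℤ; 1ℤ; -_; _+_; _-_)
import Data.Integer.Properties as ℤ
open import Data.Nat.Base using (ℕ; _≤_)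
import Data.Nat.Properties as ℕ
open import Data.Product.Base using (_×_; ∃-syntax)
open import Data.Sum.Base using (_⊎_)
open import Data.Vec.Functional using (Vector)
open import Relation.Binary.PropositionalEquality.Core using (_≡_; _≢_)
open import Relation.Nullary.Decidable.Core using (⌊_⌋)
open import Relation.Unary using (Pred; _∈_)
open import Level using (0ℓ)

open import Algebra.Properties.Monoid.Sum ℕ.+-0-monoid
  using () renaming (sum to sumℕ)
open import Algebra.Properties.Monoid.Sum ℤ.+-0-monoid
  using () renaming (sum to sumℤ)

Table : Set → ℕ → ℕ → Set
Table A I J = Fin I → Fin J → A

-- Tables are functions, so equality of tables is taken entrywise.
infix 4 _≐_
_≐_ : ∀ {I J} → Table ℤ I J → Table ℤ I J → Set
x ≐ y = ∀ i j → x i j ≡ y i j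

infixl 6 _⊕_ _⊝_
_⊕_ _⊝_ : ∀ {I J} → Table ℤ I J → Table ℤ I J → Table ℤ I J
(x ⊕ y) i j = x i j + y i j
(x ⊝ y) i j = x i j - y i j

⊝_ : ∀ {I J} → Table ℤ I J → Table ℤ I J
(⊝ x) i j = - x i j

sumTables : ∀ {I J} l → Vector (Table ℤ I J) l → Table ℤ I J
sumTables l m i j = sumℤ {l} (λ k → m k i j)

toℤ : ∀ {I J} → Table ℕ I J → Table ℤ I J
toℤ n i j = + n i j

E : ∀ {I J} → Fin I → Fin J → Table ℤ I J
E i₀ j₀ i j = if ⌊ i ≟ i₀ ⌋ ∧ ⌊ j ≟ j₀ ⌋ then 1ℤ else 0ℤ

minor : ∀ {I J} → Fin I → Fin I → Fin J → Fin J → Table ℤ I J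
minor i₁ i₂ j₁ j₂ = E i₁ j₁ ⊕ E i₂ j₂ ⊝ E i₁ j₂ ⊝ E i₂ j₁

BasicMove : ∀ {I J} → Pred (Table ℤ I J) 0ℓ
BasicMove m =
  ∃[ i₁ ] ∃[ i₂ ] ∃[ j₁ ] ∃[ j₂ ]
    i₁ ≢ i₂ × j₁ ≢ j₂ ×
    (m ≐ minor i₁ i₂ j₁ j₂ ⊎ m ≐ ⊝ minor i₁ i₂ j₁ j₂)

record Fiber {I J} (b : Table ℕ I J) (r : Vector ℕ I) (c : Vector ℕ J)
             (n : Table ℕ I J) : Set where
  field
    rowSums : ∀ i → sumℕ (λ j → n i j) ≡ r i
    colSums : ∀ j → sumℕ (λ i → n i j) ≡ c j
    bounded : ∀ i j → n i j ≤ b i j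

-- An integer table lies in a set F of ℕ-valued tables when it is the image
-- of a member of F; in particular its entries are then nonnegative.
infix 4 _∈ℤ_
_∈ℤ_ : ∀ {I J} → Table ℤ I J → Pred (Table ℕ I J) 0ℓ → Set
x ∈ℤ F = ∃[ n ] n ∈ F × toℤ n ≐ x

-- inject≤ selects the first t of the l moves.
IsMarkovSubbasis : ∀ {I J} → Pred (Table ℤ I J) 0ℓ → Pred (Table ℕ I J) 0ℓ → Set
IsMarkovSubbasis {I} {J} M F =
  ∀ u v → u ∈ F → v ∈ F →
  ∃[ l ] ∃[ m ]
    (∀ (k : Fin l) → m k ∈ M) ×
    toℤ u ≐ toℤ v ⊕ sumTables l m ×
    (∀ t → 1 ≤ t → (t≤l : t ≤ l) →
      toℤ v ⊕ sumTables t (λ k → m (inject≤ k t≤l)) ∈ℤ F)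

{-# OPTIONS --safe #-}
-- Let u ≠ v lie in the fiber, and let P i = {j | v i j < u i j}.  Take i₁ with
-- P i₁ nonempty and maximal under inclusion.  Equal row sums give j₂ with u < v at
-- (i₁,j₂), equal column sums give i₂ with v < u at (i₂,j₂); by maximality some
-- j₁ ∈ P i₁ is not in P i₂.  If u is below its bound at (i₂,j₁), the switch on these
-- four cells is legal for u; otherwise 0 < b = u ≤ v there, and the opposite switch
-- is legal for v.  Either one decreases Σ (u ∸ v), and switches are reversible.
module Submission where

open import Defs
open import Data.Bool.Base using (true; false; if_then_else_)
open import Data.Fin.Base using (Fin; zero; suc; inject≤)
open import Data.Fin.Induction using (spo-noetherian)
open import Data.Fin.Properties using (_≟_; any?; all?)
import Data.Integer.Base as ℤ
import Data.Integer.Properties as ℤₚ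
import Data.Integer.Tactic.RingSolver as ℤ-Solver
open import Data.Nat.Base
  using (ℕ; zero; suc; _+_; _*_; _∸_; _≤_; _<_; z≤n; s≤s⁻¹)
open import Data.Nat.Induction using (<-wellFounded; Acc; acc)
open import Data.Nat.Properties hiding (_≟_)
open import Data.Nat.Tactic.RingSolver using (solve-∀)
open import Data.Product.Base using (_×_; _,_; ∃-syntax)
open import Data.Sum.Base using (_⊎_; inj₁; inj₂)
open import Data.Vec.Functional using (Vector; []; _∷_)
open import Function.Base using (_∘_; flip; case_of_)
open import Level using (0ℓ)
open import Relation.Binary.Core using (Rel)
open import Relation.Binary.PropositionalEquality
open import Relation.Binary.Structures using (IsStrictPartialOrder)
open import Relation.Nullary using (¬_; yes; no; contradiction)
open import Relation.Nullary.Decidable using (⌊_⌋; _→-dec_; _×-dec_)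
open import Relation.Unary using (Pred; _∈_)

open import Algebra.Properties.CommutativeMonoid.Sum +-0-commutativeMonoid
  using (sum; ∑-distrib-+; sum-cong-≗; sum-replicate-zero)
open import Algebra.Properties.Semiring.Sum +-*-semiring
  using (*-distribˡ-sum; *-distribʳ-sum)

-- Comparison of finite sums

sum-mono-≤ : ∀ {n} {f g : Vector ℕ n} → (∀ i → f i ≤ g i) → sum f ≤ sum g
sum-mono-≤ {zero}  f≤g = z≤n
sum-mono-≤ {suc n} f≤g = +-mono-≤ (f≤g zero) (sum-mono-≤ (f≤g ∘ suc))

sum-mono-< : ∀ {n} {f g : Vector ℕ n} → (∀ i → f i ≤ g i) →
             ∀ i → f i < g i → sum f < sum g
sum-mono-< f≤g zero    lt = +-mono-<-≤ lt (sum-mono-≤ (f≤g ∘ suc))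
sum-mono-< f≤g (suc i) lt = +-mono-≤-< (f≤g zero) (sum-mono-< (f≤g ∘ suc) i lt)

-- Otherwise `f ≤ g` everywhere, strictly at `i`, and the sums would differ.
sum-≡⇒∃> : ∀ {n} {f g : Vector ℕ n} → sum f ≡ sum g →
           ∀ i → f i < g i → ∃[ k ] g k < f k
sum-≡⇒∃> {f = f} {g} eq i lt with any? (λ k → g k <? f k)
... | yes found = found
... | no  none  = contradiction eq
  (<⇒≢ (sum-mono-< (λ k → ≮⇒≥ λ gk<fk → none (k , gk<fk)) i lt))

-- Unit vectors and unit tables

δ : ∀ {n} → Fin n → Vector ℕ n
δ i₀ i = if ⌊ i ≟ i₀ ⌋ then 1 else 0

δ-suc : ∀ {n} (i₀ i : Fin n) → δ (suc i₀) (suc i) ≡ δ i₀ i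
δ-suc i₀ i with i ≟ i₀
... | yes _ = refl
... | no _  = refl

sum-δ : ∀ {n} (i₀ : Fin n) → sum (δ i₀) ≡ 1
sum-δ {suc n} zero     = cong suc (sum-replicate-zero n)
sum-δ {suc n} (suc i₀) = trans (sum-cong-≗ (δ-suc i₀)) (sum-δ i₀)

module _ {I J : ℕ} where

  infixl 6 _⊞_
  _⊞_ : Table ℕ I J → Table ℕ I J → Table ℕ I J
  (x ⊞ y) i j = x i j + y i j

  -- The natural-number form of `E`, written as a product so that row and column sums factor.
  e : Fin I → Fin J → Table ℕ I J
  e i₀ j₀ i j = δ i₀ i * δ j₀ j

  toℤ-e : ∀ i₀ j₀ → toℤ (e i₀ j₀) ≐ E i₀ j₀
  toℤ-e i₀ j₀ i j with ⌊ i ≟ i₀ ⌋ | ⌊ j ≟ j₀ ⌋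
  ... | false | _     = refl
  ... | true  | false = refl
  ... | true  | true  = refl

  rowSum-e : ∀ i₀ j₀ i → sum (λ j → e i₀ j₀ i j) ≡ δ i₀ i
  rowSum-e i₀ j₀ i = begin
    sum (λ j → δ i₀ i * δ j₀ j) ≡⟨ *-distribˡ-sum (δ i₀ i) (δ j₀) ⟨
    δ i₀ i * sum (δ j₀)         ≡⟨ cong (δ i₀ i *_) (sum-δ j₀) ⟩
    δ i₀ i * 1                  ≡⟨ *-identityʳ _ ⟩
    δ i₀ i                      ∎
    where open ≡-Reasoning

  colSum-e : ∀ i₀ j₀ j → sum (λ i → e i₀ j₀ i j) ≡ δ j₀ j
  colSum-e i₀ j₀ j = begin
    sum (λ i → δ i₀ i * δ j₀ j) ≡⟨ *-distribʳ-sum (δ j₀ j) (δ i₀) ⟨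
    sum (δ i₀) * δ j₀ j         ≡⟨ cong (_* δ j₀ j) (sum-δ i₀) ⟩
    1 * δ j₀ j                  ≡⟨ *-identityˡ _ ⟩
    δ j₀ j                      ∎
    where open ≡-Reasoning

  e≤ : ∀ {i₀ j₀} (f : Table ℕ I J) → 0 < f i₀ j₀ → ∀ i j → e i₀ j₀ i j ≤ f i j
  e≤ {i₀} {j₀} f pos i j with i ≟ i₀ | j ≟ j₀
  ... | yes refl | yes refl = pos
  ... | yes _    | no _     = z≤n
  ... | no _     | _        = z≤n

  e-rows : ∀ {i₁ i₂ j₁ j₂} → i₁ ≢ i₂ → ∀ i j → e i₁ j₁ i j ≡ 0 ⊎ e i₂ j₂ i j ≡ 0
  e-rows {i₁} {i₂} i₁≢i₂ i j with i ≟ i₁ | i ≟ i₂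
  ... | no _     | _        = inj₁ refl
  ... | yes _    | no _     = inj₂ refl
  ... | yes refl | yes refl = contradiction refl i₁≢i₂

  -- Distinct rows keep the two units apart, so in each cell at most one summand is nonzero and `e≤`
  -- for the other suffices.
  e⊞e≤ : ∀ {i₁ i₂ j₁ j₂} (f : Table ℕ I J) → i₁ ≢ i₂ →
         0 < f i₁ j₁ → 0 < f i₂ j₂ → ∀ i j → (e i₁ j₁ ⊞ e i₂ j₂) i j ≤ f i j
  e⊞e≤ {i₁} {i₂} {j₁} {j₂} f i₁≢i₂ pos₁ pos₂ i j
    with e i₁ j₁ i j | e i₂ j₂ i j
       | e≤ f pos₁ i j | e≤ f pos₂ i j | e-rows {j₁ = j₁} {j₂} i₁≢i₂ i j
  ... | _ | _ | _  | p₂ | inj₁ refl = p₂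
  ... | x | _ | p₁ | _  | inj₂ refl = ≤-trans (≤-reflexive (+-identityʳ x)) p₁

  total : Table ℕ I J → ℕ
  total x = sum (λ i → sum (x i))

  total-⊞ : ∀ x y → total (x ⊞ y) ≡ total x + total y
  total-⊞ x y = trans (sum-cong-≗ (λ i → ∑-distrib-+ (x i) (y i)))
                      (∑-distrib-+ (sum ∘ x) (sum ∘ y))

  total-mono : ∀ {x y} → (∀ i j → x i j ≤ y i j) → total x ≤ total y
  total-mono x≤y = sum-mono-≤ (λ i → sum-mono-≤ (x≤y i))

  total-e : ∀ i₀ j₀ → total (e i₀ j₀) ≡ 1
  total-e i₀ j₀ = trans (sum-cong-≗ (rowSum-e i₀ j₀)) (sum-δ i₀)

  -- Switches on four cells and their margins

  -- Addition of `minor i₁ i₂ j₁ j₂`, with the subtracted units moved to the left to stay in ℕ. Read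
  -- from right to left, it is the reverse switch, with `j₁` and `j₂` exchanged.
  Switch : Fin I → Fin I → Fin J → Fin J → Rel (Table ℕ I J) 0ℓ
  Switch i₁ i₂ j₁ j₂ w w′ = ∀ i j →
    (w′ ⊞ (e i₁ j₂ ⊞ e i₂ j₁)) i j ≡ (w ⊞ (e i₁ j₁ ⊞ e i₂ j₂)) i j

  Switch⇒minor : ∀ {i₁ i₂ j₁ j₂} w w′ → Switch i₁ i₂ j₁ j₂ w w′ →
                 toℤ w′ ≐ toℤ w ⊕ minor i₁ i₂ j₁ j₂
  Switch⇒minor {i₁} {i₂} {j₁} {j₂} w w′ sw i j
    rewrite sym (toℤ-e i₁ j₁ i j) | sym (toℤ-e i₂ j₂ i j)
          | sym (toℤ-e i₁ j₂ i j) | sym (toℤ-e i₂ j₁ i j) =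
    trans (expand (ℤ.+ w′ i j) (ℤ.+ e i₁ j₂ i j) (ℤ.+ e i₂ j₁ i j))
   (trans (cong (λ z → ℤ.+ z ℤ.- ℤ.+ e i₁ j₂ i j ℤ.- ℤ.+ e i₂ j₁ i j) (sw i j))
          (regroup (ℤ.+ w i j) (ℤ.+ e i₁ j₁ i j) (ℤ.+ e i₂ j₂ i j)
                   (ℤ.+ e i₁ j₂ i j) (ℤ.+ e i₂ j₁ i j)))
    where
    expand : ∀ x a b → x ≡ (x ℤ.+ (a ℤ.+ b)) ℤ.- a ℤ.- b
    expand = ℤ-Solver.solve-∀
    regroup : ∀ x a b c d → (x ℤ.+ (a ℤ.+ b)) ℤ.- c ℤ.- d
                          ≡ x ℤ.+ (a ℤ.+ b ℤ.- c ℤ.- d)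
    regroup = ℤ-Solver.solve-∀

  -- Both pairs of units have one unit in row `i₁` and one in row `i₂`, so their row sums cancel.
  Switch-rowSum : ∀ {i₁ i₂ j₁ j₂} w w′ → Switch i₁ i₂ j₁ j₂ w w′ →
                  ∀ i → sum (w′ i) ≡ sum (w i)
  Switch-rowSum {i₁} {i₂} {j₁} {j₂} w w′ sw i =
    +-cancelʳ-≡ (δ i₁ i + δ i₂ i) _ _ (begin
      sum (w′ i) + (δ i₁ i + δ i₂ i)               ≡⟨ expand w′ j₂ j₁ ⟨
      sum ((w′ ⊞ (e i₁ j₂ ⊞ e i₂ j₁)) i)           ≡⟨ sum-cong-≗ (sw i) ⟩
      sum ((w ⊞ (e i₁ j₁ ⊞ e i₂ j₂)) i)            ≡⟨ expand w j₁ j₂ ⟩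
      sum (w i) + (δ i₁ i + δ i₂ i)                ∎)
    where
    open ≡-Reasoning
    expand : ∀ x j j′ → sum ((x ⊞ (e i₁ j ⊞ e i₂ j′)) i)
                      ≡ sum (x i) + (δ i₁ i + δ i₂ i)
    expand x j j′ = begin
      sum ((x ⊞ (e i₁ j ⊞ e i₂ j′)) i)             ≡⟨ ∑-distrib-+ (x i) _ ⟩
      sum (x i) + sum ((e i₁ j ⊞ e i₂ j′) i)
        ≡⟨ cong (sum (x i) +_) (∑-distrib-+ (e i₁ j i) (e i₂ j′ i)) ⟩
      sum (x i) + (sum (e i₁ j i) + sum (e i₂ j′ i))
        ≡⟨ cong (sum (x i) +_) (cong₂ _+_ (rowSum-e i₁ j i) (rowSum-e i₂ j′ i)) ⟩
      sum (x i) + (δ i₁ i + δ i₂ i)                ∎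

  Switch-colSum : ∀ {i₁ i₂ j₁ j₂} w w′ → Switch i₁ i₂ j₁ j₂ w w′ →
                  ∀ j → sum (λ i → w′ i j) ≡ sum (λ i → w i j)
  Switch-colSum {i₁} {i₂} {j₁} {j₂} w w′ sw j =
    +-cancelʳ-≡ (δ j₁ j + δ j₂ j) _ _ (begin
      sum (λ i → w′ i j) + (δ j₁ j + δ j₂ j)
        ≡⟨ cong (sum (λ i → w′ i j) +_) (+-comm (δ j₁ j) _) ⟩
      sum (λ i → w′ i j) + (δ j₂ j + δ j₁ j)       ≡⟨ expand w′ j₂ j₁ ⟨
      sum (λ i → (w′ ⊞ (e i₁ j₂ ⊞ e i₂ j₁)) i j)   ≡⟨ sum-cong-≗ (λ i → sw i j) ⟩
      sum (λ i → (w ⊞ (e i₁ j₁ ⊞ e i₂ j₂)) i j)    ≡⟨ expand w j₁ j₂ ⟩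
      sum (λ i → w i j) + (δ j₁ j + δ j₂ j)        ∎)
    where
    open ≡-Reasoning
    expand : ∀ x k k′ → sum (λ i → (x ⊞ (e i₁ k ⊞ e i₂ k′)) i j)
                      ≡ sum (λ i → x i j) + (δ k j + δ k′ j)
    expand x k k′ = begin
      sum (λ i → (x ⊞ (e i₁ k ⊞ e i₂ k′)) i j)
        ≡⟨ ∑-distrib-+ (λ i → x i j) _ ⟩
      sum (λ i → x i j) + sum (λ i → (e i₁ k ⊞ e i₂ k′) i j)
        ≡⟨ cong (sum (λ i → x i j) +_)
             (∑-distrib-+ (λ i → e i₁ k i j) (λ i → e i₂ k′ i j)) ⟩
      sum (λ i → x i j) + (sum (λ i → e i₁ k i j) + sum (λ i → e i₂ k′ i j))
        ≡⟨ cong (sum (λ i → x i j) +_) (cong₂ _+_ (colSum-e i₁ k j) (colSum-e i₂ k′ j)) ⟩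
      sum (λ i → x i j) + (δ k j + δ k′ j)         ∎

  -- The excess and its decrease

  -- Half the L1 distance when `u` and `v` have equal totals, as in a fiber.
  excess : Table ℕ I J → Table ℕ I J → ℕ
  excess u v = total (λ i j → u i j ∸ v i j)

  total-e⊞e : ∀ i₁ i₂ j₁ j₂ → total (e i₁ j₁ ⊞ e i₂ j₂) ≡ 2
  total-e⊞e i₁ i₂ j₁ j₂ = trans (total-⊞ (e i₁ j₁) (e i₂ j₂))
    (cong₂ _+_ (total-e i₁ j₁) (total-e i₂ j₂))

  -- Covers both a switch of x with y fixed and the opposite switch of y with x
  -- fixed; p, a and c are the entries of e i₁ j₁ ⊞ e i₂ j₂, e i₁ j₂ and e i₂ j₁.
  ∸-switch : ∀ x y x′ y′ p a c → p ≤ x ∸ y → a ≤ y ∸ x →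
             x′ + p + y ≡ x + (a + c) + y′ → (x′ ∸ y′) + p ≤ (x ∸ y) + c
  ∸-switch x y x′ y′ p a c p≤ a≤ eq with ≤-total x y
  -- Here `x ∸ y` vanishes, which forces `p` to be 0, and the bound on `a` gives `a + x ≤ y`.
  ... | inj₁ x≤y
    rewrite m≤n⇒m∸n≡0 x≤y | n≤0⇒n≡0 p≤ | +-identityʳ x′ | +-identityʳ (x′ ∸ y′) =
    m≤n+o⇒m∸n≤o x′ y′ (+-cancelʳ-≤ y x′ (y′ + c) (begin
      x′ + y           ≡⟨ eq ⟩
      x + (a + c) + y′ ≡⟨ regroup x a c y′ ⟩
      a + x + (y′ + c) ≤⟨ +-monoˡ-≤ (y′ + c) (m≤o∸n⇒m+n≤o a x≤y a≤) ⟩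
      y + (y′ + c)     ≡⟨ +-comm y (y′ + c) ⟩
      y′ + c + y       ∎))
    where
    open ≤-Reasoning
    regroup : ∀ x a c y′ → x + (a + c) + y′ ≡ a + x + (y′ + c)
    regroup = solve-∀
  -- Here `a` is 0, and `p ≤ x ∸ y` yields `y′ ≤ x′`, so no subtraction truncates and equality
  -- holds.
  ... | inj₂ y≤x rewrite m≤n⇒m∸n≡0 y≤x | n≤0⇒n≡0 a≤ = begin
      (x′ ∸ y′) + p ≡⟨ +-∸-comm p y′≤x′ ⟨
      (x′ + p) ∸ y′ ≡⟨ cong (_∸ y′) sum≡ ⟩
      ((x ∸ y) + c + y′) ∸ y′ ≡⟨ m+n∸n≡m _ y′ ⟩
      (x ∸ y) + c   ∎
    where
    open ≤-Reasoning
    regroup : ∀ d y c y′ → d + y + c + y′ ≡ d + c + y′ + y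
    regroup = solve-∀
    sum≡ : x′ + p ≡ (x ∸ y) + c + y′
    sum≡ = +-cancelʳ-≡ y _ _ (trans eq (trans
      (cong (λ z → z + c + y′) (sym (m∸n+n≡m y≤x))) (regroup (x ∸ y) y c y′)))
    y′≤x′ : y′ ≤ x′
    y′≤x′ = +-cancelʳ-≤ p y′ x′ (begin
      y′ + p            ≤⟨ +-monoʳ-≤ y′ (m≤n⇒m≤n+o c p≤) ⟩
      y′ + (x ∸ y + c)  ≡⟨ +-comm y′ _ ⟩
      x ∸ y + c + y′    ≡⟨ sum≡ ⟨
      x′ + p            ∎)

  -- Summing `∸-switch` gives new excess + 2 ≤ old excess + 1: the cells `(i₁ , j₁)` and `(i₂ , j₂)`
  -- save a unit each, and only `(i₂ , j₁)` can cost one.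
  excess-switch : ∀ {i₁ i₂ j₁ j₂} {x y x′ y′ : Table ℕ I J} → i₁ ≢ i₂ →
    y i₁ j₁ < x i₁ j₁ → y i₂ j₂ < x i₂ j₂ → x i₁ j₂ < y i₁ j₂ →
    (∀ i j → (x′ ⊞ (e i₁ j₁ ⊞ e i₂ j₂) ⊞ y) i j
           ≡ (x ⊞ (e i₁ j₂ ⊞ e i₂ j₁) ⊞ y′) i j) →
    excess x′ y′ < excess x y
  excess-switch {i₁} {i₂} {j₁} {j₂} {x} {y} {x′} {y′} i₁≢i₂ y₁<x₁ y₂<x₂ x<y eq =
    +-cancelʳ-≤ 1 (suc (excess x′ y′)) (excess x y) (begin
      suc (excess x′ y′) + 1                  ≡⟨ +-suc (excess x′ y′) 1 ⟨
      excess x′ y′ + 2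
        ≡⟨ cong (excess x′ y′ +_) (total-e⊞e i₁ i₂ j₁ j₂) ⟨
      excess x′ y′ + total (e i₁ j₁ ⊞ e i₂ j₂)
        ≡⟨ total-⊞ (λ i j → x′ i j ∸ y′ i j) (e i₁ j₁ ⊞ e i₂ j₂) ⟨
      total ((λ i j → x′ i j ∸ y′ i j) ⊞ (e i₁ j₁ ⊞ e i₂ j₂))
        ≤⟨ total-mono (λ i j → ∸-switch (x i j) (y i j) (x′ i j) (y′ i j)
             ((e i₁ j₁ ⊞ e i₂ j₂) i j) (e i₁ j₂ i j) (e i₂ j₁ i j)
             (e⊞e≤ (λ i j → x i j ∸ y i j) i₁≢i₂ (m<n⇒0<n∸m y₁<x₁) (m<n⇒0<n∸m y₂<x₂) i j)
             (e≤ (λ i j → y i j ∸ x i j) (m<n⇒0<n∸m x<y) i j)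
             (eq i j)) ⟩
      total ((λ i j → x i j ∸ y i j) ⊞ e i₂ j₁)
        ≡⟨ total-⊞ (λ i j → x i j ∸ y i j) (e i₂ j₁) ⟩
      excess x y + total (e i₂ j₁)            ≡⟨ cong (excess x y +_) (total-e i₂ j₁) ⟩
      excess x y + 1                          ∎)
    where open ≤-Reasoning

  -- Legal switches and paths in the fiber

  -- Signs of `u - v` on four cells. The inequality at `(i₂ , j₁)` is weak because it only says that
  -- `j₁` lies outside `P i₂`.
  record Switchable (u v : Table ℕ I J) : Set where
    constructor switchable
    field
      {i₁ i₂} : Fin I
      {j₁ j₂} : Fin J
      v<u₁₁ : v i₁ j₁ < u i₁ j₁
      u<v₁₂ : u i₁ j₂ < v i₁ j₂
      v<u₂₂ : v i₂ j₂ < u i₂ j₂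
      u≤v₂₁ : u i₂ j₁ ≤ v i₂ j₁

  module _ (b : Table ℕ I J) (r : Vector ℕ I) (c : Vector ℕ J) where

    open Fiber

    F : Pred (Table ℕ I J) 0ℓ
    F = Fiber b r c

    switch : ∀ {i₁ i₂ j₁ j₂ w} → w ∈ F → i₁ ≢ i₂ →
      0 < w i₁ j₂ → 0 < w i₂ j₁ → w i₁ j₁ < b i₁ j₁ → w i₂ j₂ < b i₂ j₂ →
      ∃[ w′ ] w′ ∈ F × Switch i₁ i₂ j₁ j₂ w w′
    switch {i₁} {i₂} {j₁} {j₂} {w} w∈F i₁≢i₂ pos₁₂ pos₂₁ w<b₁₁ w<b₂₂ =
      w′ , record
        { rowSums = λ i → trans (Switch-rowSum w w′ sw i) (rowSums w∈F i)
        ; colSums = λ j → trans (Switch-colSum w w′ sw j) (colSums w∈F j)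
        ; bounded = w′≤b
        } , sw
      where
      w′ : Table ℕ I J
      w′ i j = (w ⊞ (e i₁ j₁ ⊞ e i₂ j₂)) i j ∸ (e i₁ j₂ ⊞ e i₂ j₁) i j

      sw : Switch i₁ i₂ j₁ j₂ w w′
      -- The subtraction in `w′` is exact, since both removed units are already present in `w`.
      sw i j = m∸n+n≡m (m≤n⇒m≤n+o _ (e⊞e≤ w i₁≢i₂ pos₁₂ pos₂₁ i j))

      w′≤b : ∀ i j → w′ i j ≤ b i j
      w′≤b i j = begin
        w′ i j                        ≤⟨ m∸n≤m _ ((e i₁ j₂ ⊞ e i₂ j₁) i j) ⟩
        (w ⊞ (e i₁ j₁ ⊞ e i₂ j₂)) i j ≡⟨ +-comm (w i j) _ ⟩
        (e i₁ j₁ ⊞ e i₂ j₂) i j + w i j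
          ≤⟨ m≤o∸n⇒m+n≤o _ (bounded w∈F i j)
               (e⊞e≤ (λ i j → b i j ∸ w i j) i₁≢i₂
                  (m<n⇒0<n∸m w<b₁₁) (m<n⇒0<n∸m w<b₂₂) i j) ⟩
        b i j                         ∎
        where open ≤-Reasoning

    data Path : Rel (Table ℕ I J) 0ℓ where
      done : ∀ {v u} → (∀ i j → u i j ≡ v i j) → Path v u
      step : ∀ {v u w i₁ i₂ j₁ j₂} → i₁ ≢ i₂ → j₁ ≢ j₂ → w ∈ F →
             Switch i₁ i₂ j₁ j₂ v w → Path w u → Path v u

    -- Serves the case where `u` is switched: a path to the switched table is followed by the
    -- reverse switch back to `u`.
    snoc : ∀ {v w u i₁ i₂ j₁ j₂} → i₁ ≢ i₂ → j₁ ≢ j₂ → u ∈ F →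
           Path v w → Switch i₁ i₂ j₁ j₂ w u → Path v u
    snoc i≢ j≢ u∈F (done w≗v) sw = step i≢ j≢ u∈F
      (λ i j → trans (sw i j) (cong (_+ _) (w≗v i j))) (done (λ _ _ → refl))
    snoc i≢ j≢ u∈F (step i≢′ j≢′ x∈F sw′ path) sw =
      step i≢′ j≢′ x∈F sw′ (snoc i≢ j≢ u∈F path sw)

    -- Search for four switchable cells

    module _ {u v : Table ℕ I J} (u∈F : u ∈ F) (v∈F : v ∈ F) where

      rowDeficit : ∀ i j → v i j < u i j → ∃[ j′ ] u i j′ < v i j′
      rowDeficit i = sum-≡⇒∃> (trans (rowSums v∈F i) (sym (rowSums u∈F i)))

      colExcess : ∀ i j → u i j < v i j → ∃[ i′ ] v i′ j < u i′ j
      colExcess i j = sum-≡⇒∃> (trans (colSums u∈F j) (sym (colSums v∈F j))) i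

      infix 4 _⊏_
      -- Strict inclusion of `P i` in `P i′`.
      _⊏_ : Rel (Fin I) 0ℓ
      i ⊏ i′ = (∀ j → v i j < u i j → v i′ j < u i′ j) ×
               ∃[ j ] v i′ j < u i′ j × ¬ v i j < u i j

      ⊏-isStrictPartialOrder : IsStrictPartialOrder _≡_ _⊏_
      ⊏-isStrictPartialOrder = record
        { isEquivalence = isEquivalence
        ; irrefl        = λ { refl (_ , _ , p , ¬p) → ¬p p }
        ; trans         = λ { (f , _) (g , j , p , ¬p) →
                              (λ k → g k ∘ f k) , j , p , ¬p ∘ f j }
        ; <-resp-≈      = subst (_ ⊏_) , subst (_⊏ _)
        }

      -- Climbs to rows with larger `P` rather than fixing a maximal one beforehand; the climb ends
      -- because there are finitely many rows.
      findSwitchable : ∀ i → Acc (flip _⊏_) i → ∀ j → v i j < u i j → Switchable u v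
      findSwitchable i (acc rec) j v<u with rowDeficit i j v<u
      ... | j₂ , u<v with colExcess i j₂ u<v
      ... | i₂ , v<u₂ with all? (λ k → (v i k <? u i k) →-dec (v i₂ k <? u i₂ k))
      ... | yes P⊆P₂ =
        -- The inclusion is strict: `j₂` lies in `P i₂` but not in `P i`.
        findSwitchable i₂ (rec (P⊆P₂ , j₂ , v<u₂ , <-asym u<v)) j (P⊆P₂ j v<u)
      ... | no P⊈P₂ with any? (λ k → (v i k <? u i k) ×-dec (u i₂ k ≤? v i₂ k))
      ... | yes (k , v<u₁ , u≤v) = switchable v<u₁ u<v v<u₂ u≤v
      ... | no none = contradiction
        (λ k p → ≰⇒> (λ q → none (k , p , q))) P⊈P₂

      equal⊎switchable : (∀ i j → u i j ≡ v i j) ⊎ Switchable u v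
      equal⊎switchable with any? (λ i → any? (λ j → v i j <? u i j))
      ... | yes (i , j , v<u) = inj₂ (findSwitchable i
              (spo-noetherian ⊏-isStrictPartialOrder i) j v<u)
      -- A cell with `u < v` would, by `colExcess`, force one with `v < u` in its column.
      ... | no none = inj₁ (λ i j → ≤-antisym (u≤v i j) (v≤u i j))
        where
        u≤v : ∀ i j → u i j ≤ v i j
        u≤v i j = ≮⇒≥ (λ v<u → none (i , j , v<u))
        v≤u : ∀ i j → v i j ≤ u i j
        v≤u i j = ≮⇒≥ (λ u<v → let (k , v<u) = colExcess i j u<v in
                                 none (k , j , v<u))

    -- Connecting two tables of the fiber

    module _ (b>0 : ∀ i j → 0 < b i j) where

      connect : ∀ {u v} → u ∈ F → v ∈ F → Acc _<_ (excess u v) → Path v u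
      connect {u} {v} u∈F v∈F (acc rec) with equal⊎switchable u∈F v∈F
      ... | inj₁ u≗v = done u≗v
      ... | inj₂ (switchable {i₁} {i₂} {j₁} {j₂} v<u₁₁ u<v₁₂ v<u₂₂ u≤v₂₁) =
        case u i₂ j₁ <? b i₂ j₁ of λ where
          (yes u<b) →
            let (u′ , u′∈F , sw) = switch u∈F i₁≢i₂
                  (≤-<-trans z≤n v<u₁₁) (≤-<-trans z≤n v<u₂₂)
                  (<-≤-trans u<v₁₂ (bounded v∈F i₁ j₂)) u<b
            in snoc i₁≢i₂ j₁≢j₂ u∈F
                 (connect u′∈F v∈F (rec (excess-switch {x = u} {v} {u′} {v} i₁≢i₂ v<u₁₁ v<u₂₂ u<v₁₂
                    (λ i j → cong (_+ v i j) (sw i j)))))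
                 (λ i j → sym (sw i j))
          (no u≮b) →
            let (v′ , v′∈F , sw) = switch v∈F i₁≢i₂
                  (≤-<-trans z≤n u<v₁₂)
                  -- At `(i₂ , j₁)` one has `0 < b ≤ u ≤ v`: the absence of structural zeros
                  -- supplies the unit to remove.
                  (<-≤-trans (b>0 i₂ j₁) (≤-trans (≮⇒≥ u≮b) u≤v₂₁))
                  (<-≤-trans v<u₁₁ (bounded u∈F i₁ j₁))
                  (<-≤-trans v<u₂₂ (bounded u∈F i₂ j₂))
            in step i₁≢i₂ j₁≢j₂ v′∈F sw
                 (connect u∈F v′∈F (rec (excess-switch {x = u} {v} {u} {v′} i₁≢i₂ v<u₁₁ v<u₂₂ u<v₁₂
                    (λ i j → regroup (u i j) (sw i j)))))
        where
        i₁≢i₂ : i₁ ≢ i₂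
        i₁≢i₂ refl = <-asym u<v₁₂ v<u₂₂
        j₁≢j₂ : j₁ ≢ j₂
        j₁≢j₂ refl = <-asym v<u₁₁ u<v₁₂
        regroup : ∀ x {p q y y′} → y′ + q ≡ y + p → x + p + y ≡ x + q + y′
        regroup x {p} {q} {y} {y′} eq = begin
          x + p + y   ≡⟨ +-assoc x p y ⟩
          x + (p + y) ≡⟨ cong (x +_) (trans (+-comm p y) (trans (sym eq) (+-comm y′ q))) ⟩
          x + (q + y′) ≡⟨ +-assoc x q y′ ⟨
          x + q + y′  ∎
          where open ≡-Reasoning

    -- From paths to sequences of basic moves

    -- Unlike `IsMarkovSubbasis`, this covers `t = 0`: in the induction, the one-move prefix of a
    -- path rests on the empty prefix of its tail.
    MovesBetween : Rel (Table ℕ I J) 0ℓ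
    MovesBetween v u = ∃[ l ] ∃[ m ]
      (∀ (k : Fin l) → m k ∈ BasicMove) ×
      toℤ u ≐ toℤ v ⊕ sumTables l m ×
      (∀ t (t≤l : t ≤ l) → toℤ v ⊕ sumTables t (λ k → m (inject≤ k t≤l)) ∈ℤ F)

    Path⇒moves : ∀ {v u} → v ∈ F → Path v u → MovesBetween v u
    Path⇒moves v∈F (done u≗v) =
      0 , [] , (λ ()) ,
      (λ i j → trans (cong ℤ.+_ (u≗v i j)) (sym (ℤₚ.+-identityʳ _))) ,
      λ { zero _ → _ , v∈F , λ i j → sym (ℤₚ.+-identityʳ _) }
    Path⇒moves {v} v∈F (step {w = w} {i₁} {i₂} {j₁} {j₂} i≢ j≢ w∈F sw path) =
      let (l , m , basic , end , inside) = Path⇒moves w∈F path in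
      suc l , minor i₁ i₂ j₁ j₂ ∷ m ,
      (λ { zero    → i₁ , i₂ , j₁ , j₂ , i≢ , j≢ , inj₁ (λ _ _ → refl)
         ; (suc k) → basic k }) ,
      (λ i j → trans (end i j) (absorb i j)) ,
      λ { zero    _   → v , v∈F , λ i j → sym (ℤₚ.+-identityʳ _)
        ; (suc t) t≤l → let (n , n∈F , eq) = inside t (s≤s⁻¹ t≤l) in
                         n , n∈F , λ i j → trans (eq i j) (absorb i j) }
      where
      -- Moves the first minor from the base table `w` into the sum over the lengthened list of
      -- moves.
      absorb : ∀ i j {s} → toℤ w i j ℤ.+ s ≡ toℤ v i j ℤ.+ (minor i₁ i₂ j₁ j₂ i j ℤ.+ s)
      absorb i j {s} = trans (cong (ℤ._+ s) (Switch⇒minor v w sw i j))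
                             (ℤₚ.+-assoc (toℤ v i j) (minor i₁ i₂ j₁ j₂ i j) s)

theorem3 : (I J : ℕ) → 1 ≤ I → 1 ≤ J →
    (b : Table ℕ I J) → (∀ i j → 0 < b i j) →
    (r : Vector ℕ I) (c : Vector ℕ J) →
    IsMarkovSubbasis BasicMove (Fiber b r c)
theorem3 I J _ _ b b>0 r c u v u∈F v∈F =
  let (l , m , basic , end , inside) = Path⇒moves b r c v∈F
        (connect b r c b>0 u∈F v∈F (<-wellFounded _))
  in l , m , basic , end , λ t _ → inside t
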